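{- Let $u,w\in S_\infty$, let $\lambda$ be a partition, and suppose $P\in\mathrm{Path}_\lambda(u,w)$. Then $\mathrm{weight}_{P,\lambda}(y;y)$ is Graham-nonnegative.
   Context: **Permutations.** $\mathbb{N}=\{1,2,3,\dots\}$. $S_\infty$ is the group of bijections $\mathbb{N}\to\mathbb{N}$ fixing all but finitely many elements, with product $(uv)(i)=u(v(i))$. $t_{ab}=t_{ba}$ ($a\ne b$) is the transposition of $a$ and $b$. $\ell(u)$ is the number of pairs $i<j$ with $u(i)>u(j)$. **The relation $\xrightarrow{k}$ and weights.** For $u,u'\in S_\infty$ and a positive integer $k$, write $u\xrightarrow{k}u'$ if there exist $p$ with $0\le p\le k$ and transpositions $t_{a_1b_1},\dots,t_{a_pb_p}$ such that (1) $a_i\le k<b_i$ for all $i$; (2) $a_i\ne a_j$ for $i\neq j$; (3) $\ell(ut_{a_1b_1}\cdots t_{a_ib_i})=\ell(u)+i$ for all $i$; (4) $u'=ut_{a_1b_1}\cdots t_{a_pb_p}$. If $u\xrightarrow{k}w$, let $P_k(u,w)=\{u(i)\mid i\le k,\ u(i)=w(i)\}$ and $\mathrm{weight}_{u,k}^w(y;z_j)=\prod_{i\in P_k(u,w)}(y_i-z_j)$ (empty product $=1$), where $y_i,z_i$ ($i\in\mathbb{N}$) are indeterminates. For a partition $\lambda=(\lambda_1\ge\dots\ge\lambda_m>0)$ of length $m$, $\mathrm{Path}_\lambda(u,w)$ is the set of sequences $(u_0,\dots,u_m)$ in $S_\infty$ with $u=u_0\xrightarrow{\lambda_1}u_1\xrightarrow{\lambda_2}\cdots\xrightarrow{\lambda_m}u_m=w$,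 and for such a path $P$, $\mathrm{weight}_{P,\lambda}(y;z)=\prod_{i=1}^m\mathrm{weight}_{u_{i-1},\lambda_i}^{u_i}(y;z_i)$. $\mathrm{weight}_{P,\lambda}(y;y)$ is the result of substituting $z_i=y_i$ for all $i$. **Graham-nonnegative.** A polynomial in the $y_i$ is Graham-nonnegative if it can be expressed as a polynomial with nonnegative integer coefficients in the simple negative roots $\alpha_i=y_{i+1}-y_i$ ($i\ge1$). (The zero polynomial is Graham-nonnegative.) -}

module Defs where

open import Algebra.Bundles using (CommutativeSemiring)
open import Algebra.Morphism.Structures using (module SemiringMorphisms)
open import Data.Fin using (Fin; inject₁; toℕ; fromℕ) renaming (zero to fzero; suc to fsuc)
open import Data.Integer using (ℤ; +_; -1ℤ)
import Data.Integer.Properties as ℤ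
open import Data.List
  using (List; []; _∷_; length; map; filter; foldl; foldr; take; tabulate; lookup; upTo; cartesianProduct)
open import Data.List.Relation.Unary.All using (All)
open import Data.List.Relation.Unary.Linked using (Linked)
open import Data.List.Relation.Unary.Unique.Propositional using (Unique)
open import Data.Nat using (ℕ; suc; _+_; _≤_; _≥_; _<_; _>_; _⊔_; _≟_; _<?_)
import Data.Nat.Properties as ℕ
open import Data.Product using (∃; _×_; _,_; proj₁; proj₂; uncurry)
open import Function using (_↔_; Inverse; mk↔ₛ′)
open import Function.Construct.Composition using (_↔-∘_)
open import Level using () renaming (_⊔_ to _⊔ˡ_)
open import Relation.Binary.PropositionalEquality using (_≡_; refl; sym; trans; cong)
open import Relation.Nullary using (yes; no; contradiction)
open import Relation.Nullary.Decidable using (_×-dec_)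

-- Convention: the set {1,2,3,…} that indexes positions, values, indeterminates
-- and the steps of a path is represented by ℕ, with n standing for n + 1.
-- Hence "i ≤ k" for a position i reads i < k here, and "k < b" reads k ≤ b.
-- The numbers k, ℓ(u) and the parts of a partition are not shifted.

------------------------------------------------------------------------
-- The group S∞

record S∞ : Set where
  field
    bijection : ℕ ↔ ℕ

  infixl 20 _⟨$⟩_
  _⟨$⟩_ : ℕ → ℕ
  _⟨$⟩_ = Inverse.to bijection

  field
    bound   : ℕ
    fixes-≥ : ∀ i → bound ≤ i → _⟨$⟩_ i ≡ i

open S∞ public using (_⟨$⟩_)

infix 4 _≗_
_≗_ : S∞ → S∞ → Set
u ≗ v = ∀ i → u ⟨$⟩ i ≡ v ⟨$⟩ i

infixl 7 _·_
_·_ : S∞ → S∞ → S∞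
u · v = record
  { bijection = S∞.bijection u ↔-∘ S∞.bijection v
  ; bound     = S∞.bound u ⊔ S∞.bound v
  ; fixes-≥   = λ i N≤i → trans
      (cong (u ⟨$⟩_) (S∞.fixes-≥ v i (ℕ.≤-trans (ℕ.m≤n⊔m (S∞.bound u) (S∞.bound v)) N≤i)))
      (S∞.fixes-≥ u i (ℕ.≤-trans (ℕ.m≤m⊔n (S∞.bound u) (S∞.bound v)) N≤i))
  }

swap : ℕ → ℕ → ℕ → ℕ
swap a b i with i ≟ a | i ≟ b
... | yes _ | _     = b
... | no  _ | yes _ = a
... | no  _ | no  _ = i

swap-involutive : ∀ a b i → swap a b (swap a b i) ≡ i
swap-involutive a b i with i ≟ a | i ≟ b
swap-involutive a b i | yes i≡a | _ with b ≟ a | b ≟ b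
... | yes b≡a | _     = trans b≡a (sym i≡a)
... | no  _   | yes _ = sym i≡a
... | no  _   | no ¬p = contradiction refl ¬p
swap-involutive a b i | no _ | yes i≡b with a ≟ a | a ≟ b
... | yes _ | _ = sym i≡b
... | no ¬p | _ = contradiction refl ¬p
swap-involutive a b i | no i≢a | no i≢b with i ≟ a | i ≟ b
... | yes i≡a | _       = contradiction i≡a i≢a
... | no  _   | yes i≡b = contradiction i≡b i≢b
... | no  _   | no  _   = refl

swap-fixes : ∀ a b i → suc (a ⊔ b) ≤ i → swap a b i ≡ i
swap-fixes a b i m<i with i ≟ a | i ≟ b
... | yes refl | _        = contradiction (ℕ.m≤m⊔n i b) (ℕ.<⇒≱ m<i)
... | no  _    | yes refl = contradiction (ℕ.m≤n⊔m a i) (ℕ.<⇒≱ m<i)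
... | no  _    | no  _    = refl

t : ℕ → ℕ → S∞
t a b = record
  { bijection = mk↔ₛ′ (swap a b) (swap a b) (swap-involutive a b) (swap-involutive a b)
  ; bound     = suc (a ⊔ b)
  ; fixes-≥   = swap-fixes a b
  }

-- Every inversion i < j satisfies j < bound, since u permutes the numbers
-- below its bound and fixes the others; so nothing is lost by the cut-off.
ℓ : S∞ → ℕ
ℓ u = length (filter
  (λ ij → (proj₁ ij <? proj₂ ij) ×-dec (u ⟨$⟩ proj₂ ij <? u ⟨$⟩ proj₁ ij))
  (cartesianProduct (upTo (S∞.bound u)) (upTo (S∞.bound u))))

------------------------------------------------------------------------
-- The relation u ─[ k ]→ u′

-- u · t a₁ b₁ · ⋯ · t aₚ bₚ
_·⋯_ : S∞ → List (ℕ × ℕ) → S∞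
u ·⋯ ts = foldl (λ v ab → v · uncurry t ab) u ts

record _─[_]→_ (u : S∞) (k : ℕ) (u′ : S∞) : Set where
  field
    ts         : List (ℕ × ℕ)
    p≤k        : length ts ≤ k
    a≤k<b      : All (λ ab → proj₁ ab < k × k ≤ proj₂ ab) ts
    a-distinct : Unique (map proj₁ ts)
    -- i : Fin p again stands for the 1-based index suc (toℕ i)
    ℓ-grows    : ∀ (i : Fin (length ts)) →
                 ℓ (u ·⋯ take (suc (toℕ i)) ts) ≡ ℓ u + suc (toℕ i)
    target     : u′ ≗ u ·⋯ ts

------------------------------------------------------------------------
-- Partitions and paths

record Partition : Set where
  field
    parts      : List ℕ
    decreasing : Linked _≥_ parts
    positive   : All (_> 0) parts

  len : ℕ
  len = length parts

  part : Fin len → ℕ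
  part = lookup parts

open Partition public using (len; part)

record Path (μ : Partition) (u w : S∞) : Set where
  field
    vertex : Fin (suc (len μ)) → S∞
    start  : vertex fzero ≗ u
    end    : vertex (fromℕ (len μ)) ≗ w
    step   : ∀ (i : Fin (len μ)) → vertex (inject₁ i) ─[ part μ i ]→ vertex (fsuc i)

------------------------------------------------------------------------
-- Polynomials

-- The polynomial ring R[V] over an arbitrary set V of indeterminates is the
-- free commutative R-algebra on V: expressions modulo the congruence generated
-- by the commutative semiring laws and the requirement that the constants form
-- a copy of R.  R is only assumed to be a semiring so that ℕ[V] is included.
-- For R = ℤ additive inverses come for free, as con -1ℤ ⊗ p.
module Polynomial {c ℓ} (R : CommutativeSemiring c ℓ) where
  private module R = CommutativeSemiring R

  infixl 6 _⊕_
  infixl 7 _⊗_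
  infix  4 _≈_

  data Poly (V : Set) : Set c where
    con : R.Carrier → Poly V
    var : V → Poly V
    _⊕_ : Poly V → Poly V → Poly V
    _⊗_ : Poly V → Poly V → Poly V

  data _≈_ {V : Set} : Poly V → Poly V → Set (c ⊔ˡ ℓ) where
    ≈-refl      : ∀ {p} → p ≈ p
    ≈-sym       : ∀ {p q} → p ≈ q → q ≈ p
    ≈-trans     : ∀ {p q r} → p ≈ q → q ≈ r → p ≈ r
    ⊕-cong      : ∀ {p p′ q q′} → p ≈ p′ → q ≈ q′ → p ⊕ q ≈ p′ ⊕ q′
    ⊗-cong      : ∀ {p p′ q q′} → p ≈ p′ → q ≈ q′ → p ⊗ q ≈ p′ ⊗ q′
    con-cong    : ∀ {a b} → a R.≈ b → con a ≈ con b
    con-+       : ∀ a b → con (a R.+ b) ≈ con a ⊕ con b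
    con-*       : ∀ a b → con (a R.* b) ≈ con a ⊗ con b
    ⊕-assoc     : ∀ p q r → (p ⊕ q) ⊕ r ≈ p ⊕ (q ⊕ r)
    ⊕-comm      : ∀ p q → p ⊕ q ≈ q ⊕ p
    ⊕-identityˡ : ∀ p → con R.0# ⊕ p ≈ p
    ⊗-assoc     : ∀ p q r → (p ⊗ q) ⊗ r ≈ p ⊗ (q ⊗ r)
    ⊗-comm      : ∀ p q → p ⊗ q ≈ q ⊗ p
    ⊗-identityˡ : ∀ p → con R.1# ⊗ p ≈ p
    ⊗-zeroˡ     : ∀ p → con R.0# ⊗ p ≈ con R.0#
    ⊗-distribˡ  : ∀ p q r → p ⊗ (q ⊕ r) ≈ (p ⊗ q) ⊕ (p ⊗ r)

  polynomialSemiring : Set → CommutativeSemiring c (c ⊔ˡ ℓ)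
  polynomialSemiring V = record
    { Carrier = Poly V ; _≈_ = _≈_ ; _+_ = _⊕_ ; _*_ = _⊗_
    ; 0# = con R.0# ; 1# = con R.1#
    ; isCommutativeSemiring = record
      { isSemiring = record
        { isSemiringWithoutAnnihilatingZero = record
          { +-isCommutativeMonoid = record
            { isMonoid = record
              { isSemigroup = record
                { isMagma = record
                  { isEquivalence = record
                    { refl = ≈-refl ; sym = ≈-sym ; trans = ≈-trans }
                  ; ∙-cong = ⊕-cong }
                ; assoc = ⊕-assoc }
              ; identity = ⊕-identityˡ
                         , λ p → ≈-trans (⊕-comm p (con R.0#)) (⊕-identityˡ p) }
            ; comm = ⊕-comm }
          ; *-cong = ⊗-cong
          ; *-assoc = ⊗-assoc
          ; *-identity = ⊗-identityˡ
                       , λ p → ≈-trans (⊗-comm p (con R.1#)) (⊗-identityˡ p)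
          ; distrib = ⊗-distribˡ
                    , λ p q r → ≈-trans (⊗-comm (q ⊕ r) p)
                        (≈-trans (⊗-distribˡ p q r) (⊕-cong (⊗-comm p q) (⊗-comm p r))) }
        ; zero = ⊗-zeroˡ
               , λ p → ≈-trans (⊗-comm p (con R.0#)) (⊗-zeroˡ p) }
      ; *-comm = ⊗-comm } }

  -- The product of the empty list is 1.
  ∏ : ∀ {V} → List (Poly V) → Poly V
  ∏ = foldr _⊗_ (con R.1#)

  module _ {c′ ℓ′} (S : CommutativeSemiring c′ ℓ′) where
    private module S = CommutativeSemiring S

    eval : (R.Carrier → S.Carrier) → {V : Set} → (V → S.Carrier) → Poly V → S.Carrier
    eval φ ρ (con a) = φ a
    eval φ ρ (var x) = ρ x
    eval φ ρ (p ⊕ q) = eval φ ρ p S.+ eval φ ρ q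
    eval φ ρ (p ⊗ q) = eval φ ρ p S.* eval φ ρ q

    open SemiringMorphisms R.rawSemiring S.rawSemiring

    -- Evaluation depends only on the polynomial, not on the expression.
    eval-cong : ∀ {φ} → IsSemiringHomomorphism φ → ∀ {V : Set} (ρ : V → S.Carrier)
                {p q} → p ≈ q → eval φ ρ p S.≈ eval φ ρ q
    eval-cong {φ} hom {V} ρ = go
      where
      open IsSemiringHomomorphism hom using (⟦⟧-cong; +-homo; *-homo; 0#-homo; 1#-homo)
      e : Poly V → S.Carrier
      e = eval φ ρ
      go : ∀ {p q} → p ≈ q → e p S.≈ e q
      go ≈-refl             = S.refl
      go (≈-sym r)          = S.sym (go r)
      go (≈-trans r s)      = S.trans (go r) (go s)
      go (⊕-cong r s)       = S.+-cong (go r) (go s)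
      go (⊗-cong r s)       = S.*-cong (go r) (go s)
      go (con-cong r)       = ⟦⟧-cong r
      go (con-+ a b)        = +-homo a b
      go (con-* a b)        = *-homo a b
      go (⊕-assoc p q r)    = S.+-assoc (e p) (e q) (e r)
      go (⊕-comm p q)       = S.+-comm (e p) (e q)
      go (⊕-identityˡ p)    = S.trans (S.+-congʳ 0#-homo) (S.+-identityˡ (e p))
      go (⊗-assoc p q r)    = S.*-assoc (e p) (e q) (e r)
      go (⊗-comm p q)       = S.*-comm (e p) (e q)
      go (⊗-identityˡ p)    = S.trans (S.*-congʳ 1#-homo) (S.*-identityˡ (e p))
      go (⊗-zeroˡ p)        = S.trans (S.*-congʳ 0#-homo) (S.trans (S.zeroˡ (e p)) (S.sym 0#-homo))
      go (⊗-distribˡ p q r) = S.distribˡ (e p) (e q) (e r)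

module ℤPoly = Polynomial ℤ.+-*-commutativeSemiring
module ℕPoly = Polynomial ℕ.+-*-commutativeSemiring

open ℤPoly public using (con; var; _⊕_; _⊗_; _≈_; ∏)

ℤ[_] ℕ[_] : Set → Set
ℤ[ V ] = ℤPoly.Poly V
ℕ[ V ] = ℕPoly.Poly V

infixl 6 _⊖_
_⊖_ : ∀ {V} → ℤ[ V ] → ℤ[ V ] → ℤ[ V ]
p ⊖ q = p ⊕ con -1ℤ ⊗ q

substitute : ∀ {V W : Set} → (V → ℤ[ W ]) → ℤ[ V ] → ℤ[ W ]
substitute {W = W} = ℤPoly.eval (ℤPoly.polynomialSemiring W) con

substituteℕ : ∀ {V W : Set} → (V → ℤ[ W ]) → ℕ[ V ] → ℤ[ W ]
substituteℕ {W = W} = ℕPoly.eval (ℤPoly.polynomialSemiring W) (λ n → con (+ n))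

------------------------------------------------------------------------
-- Weights

data Var : Set where
  y z : ℕ → Var

P⟨_⟩ : ℕ → S∞ → S∞ → List ℕ
P⟨ k ⟩ u w = map (u ⟨$⟩_) (filter (λ i → u ⟨$⟩ i ≟ w ⟨$⟩ i) (upTo k))

stepWeight : S∞ → ℕ → S∞ → ℕ → ℤ[ Var ]
stepWeight u k w j = ∏ (map (λ i → var (y i) ⊖ var (z j)) (P⟨ k ⟩ u w))

weight : ∀ {μ u w} → Path μ u w → ℤ[ Var ]
weight {μ} P = ∏ (tabulate λ (i : Fin (len μ)) →
  stepWeight (vertex (inject₁ i)) (part μ i) (vertex (fsuc i)) (toℕ i))
  where open Path P

-- The indeterminates of the target ring ℤ[ ℕ ] are the y's.
z≔y : ℤ[ Var ] → ℤ[ ℕ ]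
z≔y = substitute λ where
  (y i) → var i
  (z i) → var i

------------------------------------------------------------------------
-- Graham-nonnegativity

α : ℕ → ℤ[ ℕ ]
α i = var (suc i) ⊖ var i

GrahamNonnegative : ℤ[ ℕ ] → Set
GrahamNonnegative p = ∃ λ (q : ℕ[ ℕ ]) → p ≈ substituteℕ α q

{-# OPTIONS --safe #-}

-- A step u ─[ k ]→ u′ can only increase the values at the positions j < k,
-- since u t_ab with a < b has one inversion more than u only if u(a) < u(b).
-- Suppose that step i fixes the value v at position j < λᵢ.  As λ is decreasing,
-- the values f(0) ≤ f(1) ≤ ⋯ ≤ f(i) = v at position j are monotone throughout the
-- first i steps.  If v < i, let s be the last index with s ≤ f(s): then
-- s ≤ f(s) ≤ f(s+1) < s + 1, so step s fixes the value s and contributes the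
-- factor y_s - y_s = 0.  Hence the weight is zero unless all its factors
-- y_v - y_i satisfy i ≤ v, and those are sums of simple negative roots.

module Submission where

open import Defs

open import Algebra.Bundles using (CommutativeSemiring)
open import Data.Fin using (Fin; inject₁; toℕ) renaming (zero to fzero; suc to fsuc)
open import Data.Fin.Induction using (<-weakInduction)
import Data.Fin.Properties as Fin
open import Data.Integer using (+_; -1ℤ)
open import Data.List using (List; []; _∷_; length; filter; take; lookup; upTo; cartesianProduct)
open import Data.List.Membership.Propositional using (_∈_)
open import Data.List.Membership.Propositional.Properties
  using (∈-lookup; ∈-upTo⁺; ∈-upTo⁻; ∈-filter⁺; ∈-filter⁻; ∈-map⁺; ∈-map∘filter⁻; ∈-cartesianProduct⁺)
open import Data.List.Relation.Unary.All as All using (All; []; _∷_)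
import Data.List.Relation.Unary.All.Properties as All
open import Data.List.Relation.Unary.Any as Any using (Any; here; there; any?)
import Data.List.Relation.Unary.Any.Properties as Any
open import Data.List.Relation.Unary.Linked as Linked using (Linked)
open import Data.List.Relation.Unary.Unique.Propositional using (Unique; _∷_)
import Data.List.Relation.Unary.Unique.Propositional.Properties as Unique
open import Data.Maybe.Relation.Binary.Connected using (just)
open import Data.Nat
  using (ℕ; suc; _+_; _≤_; _<_; _≥_; z≤n; s≤s; _≟_; _<?_; _≤′_; ≤′-refl; ≤′-step)
import Data.Nat.Properties as ℕ
open import Data.Product using (_×_; _,_; proj₁; proj₂)
open import Function using (Injection; _∘_)
open import Function.Properties.Inverse using (↔⇒↣)
open import Relation.Binary.PropositionalEquality
  using (_≡_; _≢_; refl; sym; trans; cong; cong₂; subst; subst₂)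
open import Relation.Nullary using (¬_; yes; no; contradiction)
open import Relation.Nullary.Decidable using (_×-dec_)

-- Counting and monotonicity in lists.

private
  variable
    A B : Set

lookup-injective : {xs : List A} → Unique xs → ∀ {i j} → lookup xs i ≡ lookup xs j → i ≡ j
lookup-injective (_ ∷ _)    {fzero}  {fzero}  _  = refl
lookup-injective (x∉ ∷ _)   {fzero}  {fsuc j} eq = contradiction eq (All.lookup x∉ (∈-lookup j))
lookup-injective (x∉ ∷ _)   {fsuc i} {fzero}  eq = contradiction (sym eq) (All.lookup x∉ (∈-lookup i))
lookup-injective (_ ∷ uniq) {fsuc i} {fsuc j} eq = cong fsuc (lookup-injective uniq eq)

-- The position of `f x` in `ys` is injective in the index of `x`: equal positions give equal
-- images, hence via `g` equal entries, and `xs` has no repeats.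
length-≤-retraction : {xs : List A} {ys : List B} (f : A → B) (g : B → A) → Unique xs →
                      (∀ {x} → x ∈ xs → f x ∈ ys) → (∀ {x} → x ∈ xs → g (f x) ≡ x) →
                      length xs ≤ length ys
length-≤-retraction {xs = xs} {ys} f g uniq f∈ gf = Fin.injective⇒≤ {f = h} λ {i} {j} eq →
  lookup-injective uniq
    (trans (sym (gf (∈-lookup i)))
      (trans (cong g (trans (lookup-h i) (trans (cong (lookup ys) eq) (sym (lookup-h j)))))
        (gf (∈-lookup j))))
  where
  h : Fin (length xs) → Fin (length ys)
  h i = Any.index (f∈ (∈-lookup i))
  lookup-h : ∀ i → f (lookup xs i) ≡ lookup ys (h i)
  lookup-h i = Any.lookup-index (f∈ (∈-lookup i))

lookup-decreasing : ∀ {xs} → Linked _≥_ xs → {i j : Fin (length xs)} → toℕ i ≤ toℕ j →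
                    lookup xs j ≤ lookup xs i
lookup-decreasing {_ ∷ _} dec {fzero} {j} _ =
  Linked.lookup (λ x≥y y≥z → ℕ.≤-trans y≥z x≥y) dec (just ℕ.≤-refl) j
lookup-decreasing {_ ∷ _} dec {fsuc i} {fsuc j} (s≤s i≤j) =
  lookup-decreasing (Linked.tail dec) i≤j

-- Inversions, length, and growth of values along a step.

Inversion : S∞ → ℕ × ℕ → Set
Inversion u (i , j) = i < j × u ⟨$⟩ j < u ⟨$⟩ i

-- Spelled as in `ℓ`, so that `ℓ u` is `length (inversions u)` by definition.
inversions : S∞ → List (ℕ × ℕ)
inversions u = filter
  (λ ij → (proj₁ ij <? proj₂ ij) ×-dec (u ⟨$⟩ proj₂ ij <? u ⟨$⟩ proj₁ ij))
  (cartesianProduct (upTo (S∞.bound u)) (upTo (S∞.bound u)))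

⟨$⟩-injective : ∀ u {i j} → u ⟨$⟩ i ≡ u ⟨$⟩ j → i ≡ j
⟨$⟩-injective u = Injection.injective (↔⇒↣ (S∞.bijection u))

-- Beyond the bound, j = u(j) < u(i), so `u` fixes u(i) too; injectivity then gives u(i) = i, hence
-- j < i.
inversion<bound : ∀ u {i j} → Inversion u (i , j) → j < S∞.bound u
inversion<bound u {i} {j} (i<j , uj<ui) with j <? S∞.bound u
... | yes j<N = j<N
... | no  j≮N = contradiction (subst₂ _<_ uj≡j ui≡i uj<ui) (ℕ.<-asym i<j)
  where
  N≤j : S∞.bound u ≤ j
  N≤j = ℕ.≮⇒≥ j≮N
  uj≡j : u ⟨$⟩ j ≡ j
  uj≡j = S∞.fixes-≥ u j N≤j
  ui≡i : u ⟨$⟩ i ≡ i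
  ui≡i = ⟨$⟩-injective u (S∞.fixes-≥ u (u ⟨$⟩ i)
    (ℕ.≤-trans N≤j (ℕ.<⇒≤ (subst (_< u ⟨$⟩ i) uj≡j uj<ui))))

∈-inversions⁺ : ∀ u {ij} → Inversion u ij → ij ∈ inversions u
∈-inversions⁺ u inv@(i<j , _) = ∈-filter⁺ _
  (∈-cartesianProduct⁺ (∈-upTo⁺ (ℕ.<-trans i<j j<N)) (∈-upTo⁺ j<N)) inv
  where
  j<N : _ < S∞.bound u
  j<N = inversion<bound u inv

∈-inversions⁻ : ∀ u {ij} → ij ∈ inversions u → Inversion u ij
∈-inversions⁻ u ij∈ = proj₂ (∈-filter⁻
  (λ ij → (proj₁ ij <? proj₂ ij) ×-dec (u ⟨$⟩ proj₂ ij <? u ⟨$⟩ proj₁ ij))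
  {xs = cartesianProduct (upTo (S∞.bound u)) (upTo (S∞.bound u))} ij∈)

inversions-unique : ∀ u → Unique (inversions u)
inversions-unique u = Unique.filter⁺ _
  (Unique.cartesianProduct⁺ (Unique.upTo⁺ (S∞.bound u)) (Unique.upTo⁺ (S∞.bound u)))

-- The standard injection between the inversions of u t_ab and those of u, which
-- is an involution on the pairs i < j.
transport : ℕ → ℕ → ℕ × ℕ → ℕ × ℕ
transport a b (i , j) with swap a b i <? swap a b j
... | yes _ = swap a b i , swap a b j
... | no  _ = i , j

transport-involutive : ∀ a b {i j} → i < j → transport a b (transport a b (i , j)) ≡ (i , j)
transport-involutive a b {i} {j} i<j with swap a b i <? swap a b j in eq
... | no _ rewrite eq = refl
-- The second test compares `i` and `j` themselves, so it succeeds and swaps back.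
... | yes _ with swap a b (swap a b i) <? swap a b (swap a b j)
...   | yes _ = cong₂ _,_ (swap-involutive a b i) (swap-involutive a b j)
...   | no  ≮ = contradiction
  (subst₂ _<_ (sym (swap-involutive a b i)) (sym (swap-involutive a b j)) i<j) ≮

-- If `swap a b` keeps the order of the positions, `u` takes the same two values on the moved pair.
-- Otherwise i = a or j = b, and u(b) < u(a) closes the gap between the values of `u · t a b` and
-- those of `u`.
transport-inversion : ∀ u {a b} → a < b → u ⟨$⟩ b < u ⟨$⟩ a → ∀ {ij} →
                      Inversion (u · t a b) ij → Inversion u (transport a b ij)
transport-inversion u {a} {b} a<b ub<ua {i , j} (i<j , utj<uti)
  with swap a b i <? swap a b j
... | yes ti<tj = ti<tj , utj<uti
... | no  ti≮tj = i<j , uj<ui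
  where
  uj<ui : u ⟨$⟩ j < u ⟨$⟩ i
  uj<ui with i ≟ a | i ≟ b | j ≟ a | j ≟ b
  ... | yes refl | _        | yes refl | _        = contradiction i<j (ℕ.<-irrefl refl)
  ... | yes refl | _        | no _     | yes refl = ub<ua
  ... | yes refl | _        | no _     | no _     = ℕ.<-trans utj<uti ub<ua
  ... | no _     | yes refl | yes refl | _        = contradiction i<j (ℕ.<-asym a<b)
  ... | no _     | yes refl | no _     | yes refl = contradiction i<j (ℕ.<-irrefl refl)
  ... | no _     | yes refl | no _     | no _     = contradiction (ℕ.<-trans a<b i<j) ti≮tj
  ... | no _     | no _     | yes refl | _        = contradiction (ℕ.<-trans i<j a<b) ti≮tj
  ... | no _     | no _     | no _     | yes refl = ℕ.<-trans ub<ua utj<uti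
  ... | no _     | no _     | no _     | no _     = utj<uti

ℓ-·t-≤ : ∀ u {a b} → a < b → u ⟨$⟩ b < u ⟨$⟩ a → ℓ (u · t a b) ≤ ℓ u
ℓ-·t-≤ u {a} {b} a<b ub<ua =
  length-≤-retraction (transport a b) (transport a b) (inversions-unique (u · t a b))
    (∈-inversions⁺ u ∘ transport-inversion u a<b ub<ua ∘ ∈-inversions⁻ (u · t a b))
    (transport-involutive a b ∘ proj₁ ∘ ∈-inversions⁻ (u · t a b))

ℓ-·t-grows⇒< : ∀ u {a b} → a < b → ℓ u < ℓ (u · t a b) → u ⟨$⟩ a < u ⟨$⟩ b
ℓ-·t-grows⇒< u a<b grows = ℕ.≤∧≢⇒<
  (ℕ.≮⇒≥ λ ub<ua → ℕ.<⇒≱ grows (ℓ-·t-≤ u a<b ub<ua))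
  (ℕ.<⇒≢ a<b ∘ ⟨$⟩-injective u)

-- Of the two swapped positions only `a` lies below `k`, and its value rises from u(a) to u(b).
·t-mono-below : ∀ u {a b k} → a < k → k ≤ b → ℓ u < ℓ (u · t a b) →
                ∀ {j} → j < k → u ⟨$⟩ j ≤ (u · t a b) ⟨$⟩ j
·t-mono-below u {a} {b} a<k k≤b grows {j} j<k with j ≟ a | j ≟ b
... | yes refl | _        = ℕ.<⇒≤ (ℓ-·t-grows⇒< u (ℕ.<-≤-trans a<k k≤b) grows)
... | no _     | yes refl = contradiction k≤b (ℕ.<⇒≱ j<k)
... | no _     | no _     = ℕ.≤-refl

·⋯-mono-below : ∀ u {k} ts → All (λ ab → proj₁ ab < k × k ≤ proj₂ ab) ts →
                (∀ (i : Fin (length ts)) → ℓ (u ·⋯ take (suc (toℕ i)) ts) ≡ ℓ u + suc (toℕ i)) →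
                ∀ {j} → j < k → u ⟨$⟩ j ≤ (u ·⋯ ts) ⟨$⟩ j
·⋯-mono-below u [] [] _ _ = ℕ.≤-refl
·⋯-mono-below u ((a , b) ∷ ts) ((a<k , k≤b) ∷ a≤k<b) ℓ-grows j<k = ℕ.≤-trans
  (·t-mono-below u a<k k≤b (ℕ.≤-reflexive (sym ℓv≡)) j<k)
  (·⋯-mono-below (u · t a b) ts a≤k<b ℓ-grows′ j<k)
  where
  ℓv≡ : ℓ (u · t a b) ≡ suc (ℓ u)
  ℓv≡ = trans (ℓ-grows fzero) (ℕ.+-comm (ℓ u) 1)
  -- The induction restarts at `u · t a b`, whose length already absorbs one unit of the growth.
  ℓ-grows′ : ∀ i → ℓ ((u · t a b) ·⋯ take (suc (toℕ i)) ts) ≡ ℓ (u · t a b) + suc (toℕ i)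
  ℓ-grows′ i = trans (ℓ-grows (fsuc i))
    (trans (ℕ.+-suc (ℓ u) (suc (toℕ i))) (cong (_+ suc (toℕ i)) (sym ℓv≡)))

step-mono-below : ∀ {u k u′} → u ─[ k ]→ u′ → ∀ {j} → j < k → u ⟨$⟩ j ≤ u′ ⟨$⟩ j
step-mono-below {u} s {j} j<k =
  subst (u ⟨$⟩ j ≤_) (sym (target j)) (·⋯-mono-below u ts a≤k<b ℓ-grows j<k)
  where open _─[_]→_ s

∈-P⁺ : ∀ u {k} w {i} → i < k → u ⟨$⟩ i ≡ w ⟨$⟩ i → u ⟨$⟩ i ∈ P⟨ k ⟩ u w
∈-P⁺ u w i<k eq = ∈-map⁺ (u ⟨$⟩_) (∈-filter⁺ _ (∈-upTo⁺ i<k) eq)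

-- Values along a path.

module _ {μ : Partition} {u w : S∞} (P : Path μ u w) where
  open Path P

  -- Step `i` contributes a factor y_v - y_i for each `v` listed here, so `toℕ i ∈ fixedValues i`
  -- means that one of its factors is zero.
  fixedValues : Fin (len μ) → List ℕ
  fixedValues i = P⟨ part μ i ⟩ (vertex (inject₁ i)) (vertex (fsuc i))

  module _ (no-zero : ∀ i → ¬ toℕ i ∈ fixedValues i) where

    -- The last-index argument run forwards, as an induction on `s`. The position must lie below
    -- every earlier part for each of those steps to be monotone there.
    index≤value : ∀ s j → (∀ r → toℕ r < toℕ s → j < part μ r) → toℕ s ≤ vertex s ⟨$⟩ j
    index≤value = <-weakInduction _ (λ _ _ → z≤n) grow
      where
      grow : ∀ i →
        (∀ j → (∀ r → toℕ r < toℕ (inject₁ i) → j < part μ r) → toℕ (inject₁ i) ≤ vertex (inject₁ i) ⟨$⟩ j) →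
        ∀ j → (∀ r → toℕ r < suc (toℕ i) → j < part μ r) → suc (toℕ i) ≤ vertex (fsuc i) ⟨$⟩ j
      grow i ih j j<part = ℕ.≤∧≢⇒< (ℕ.≤-trans i≤vj vj≤v′j) i≢v′j
        where
        v v′ : S∞
        v  = vertex (inject₁ i)
        v′ = vertex (fsuc i)
        i≤vj : toℕ i ≤ v ⟨$⟩ j
        i≤vj = subst (_≤ v ⟨$⟩ j) (Fin.toℕ-inject₁ i)
          (ih j λ r r<i → j<part r (ℕ.m<n⇒m<1+n (subst (toℕ r <_) (Fin.toℕ-inject₁ i) r<i)))
        vj≤v′j : v ⟨$⟩ j ≤ v′ ⟨$⟩ j
        vj≤v′j = step-mono-below (step i) (j<part i ℕ.≤-refl)
        -- Equality would squeeze the value before the step to `i` as well, so step `i` would fix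
        -- the value `i`.
        i≢v′j : toℕ i ≢ v′ ⟨$⟩ j
        i≢v′j i≡v′j = no-zero i (subst (_∈ fixedValues i) (sym i≡vj)
          (∈-P⁺ v v′ (j<part i ℕ.≤-refl) (trans (sym i≡vj) i≡v′j)))
          where
          i≡vj : toℕ i ≡ v ⟨$⟩ j
          i≡vj = ℕ.≤-antisym i≤vj (ℕ.≤-trans vj≤v′j (ℕ.≤-reflexive (sym i≡v′j)))

    -- A fixed value sits at a position below `part μ i`, hence below all earlier parts, which are
    -- at least as large.
    index≤fixedValue : ∀ i {v} → v ∈ fixedValues i → toℕ i ≤ v
    index≤fixedValue i v∈
      with j , j∈ , refl , _ ← ∈-map∘filter⁻
        (vertex (inject₁ i) ⟨$⟩_) (λ j → vertex (inject₁ i) ⟨$⟩ j ≟ vertex (fsuc i) ⟨$⟩ j) v∈ =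
      subst (_≤ vertex (inject₁ i) ⟨$⟩ j) (Fin.toℕ-inject₁ i)
        (index≤value (inject₁ i) j λ r r<i → ℕ.<-≤-trans (∈-upTo⁻ j∈)
          (lookup-decreasing (Partition.decreasing μ)
            (ℕ.<⇒≤ (subst (toℕ r <_) (Fin.toℕ-inject₁ i) r<i))))

-- Graham-nonnegative polynomials and the conclusion.

open ℤPoly using
  (≈-refl; ≈-sym; ≈-trans; ⊕-cong; ⊗-cong; con-+; ⊗-comm; ⊗-zeroˡ)

⊖-inverseʳ : ∀ {V} (p : ℤ[ V ]) → p ⊖ p ≈ con (+ 0)
⊖-inverseʳ {V} p = begin
  p ⊕ con -1ℤ ⊗ p                ≈⟨ +-congʳ (*-identityˡ p) ⟨
  con (+ 1) ⊗ p ⊕ con -1ℤ ⊗ p    ≈⟨ distribʳ p (con (+ 1)) (con -1ℤ) ⟨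
  -- The integer sum of `+ 1` and `-1ℤ` computes to `+ 0`.
  (con (+ 1) ⊕ con -1ℤ) ⊗ p      ≈⟨ *-congʳ (con-+ (+ 1) -1ℤ) ⟨
  con (+ 0) ⊗ p                  ≈⟨ zeroˡ p ⟩
  con (+ 0)                      ∎
  where
  open CommutativeSemiring (ℤPoly.polynomialSemiring V)
  open import Relation.Binary.Reasoning.Setoid setoid

⊖-telescope : ∀ {V} (p q r : ℤ[ V ]) → (p ⊖ q) ⊕ (q ⊖ r) ≈ p ⊖ r
⊖-telescope {V} p q r = begin
  (p ⊖ q) ⊕ (q ⊖ r)                      ≈⟨ +-assoc p (con -1ℤ ⊗ q) (q ⊖ r) ⟩
  p ⊕ (con -1ℤ ⊗ q ⊕ (q ⊖ r))            ≈⟨ +-congˡ (+-assoc (con -1ℤ ⊗ q) q (con -1ℤ ⊗ r)) ⟨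
  p ⊕ ((con -1ℤ ⊗ q ⊕ q) ⊕ con -1ℤ ⊗ r)  ≈⟨ +-congˡ (+-congʳ (+-comm (con -1ℤ ⊗ q) q)) ⟩
  p ⊕ ((q ⊖ q) ⊕ con -1ℤ ⊗ r)            ≈⟨ +-congˡ (+-congʳ (⊖-inverseʳ q)) ⟩
  p ⊕ (con (+ 0) ⊕ con -1ℤ ⊗ r)          ≈⟨ +-congˡ (+-identityˡ (con -1ℤ ⊗ r)) ⟩
  p ⊖ r                                  ∎
  where
  open CommutativeSemiring (ℤPoly.polynomialSemiring V)
  open import Relation.Binary.Reasoning.Setoid setoid

graham-resp-≈ : ∀ {p q} → p ≈ q → GrahamNonnegative p → GrahamNonnegative q
graham-resp-≈ p≈q (r , p≈r) = r , ≈-trans (≈-sym p≈q) p≈r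

graham-con : ∀ n → GrahamNonnegative (con (+ n))
graham-con n = ℕPoly.con n , ≈-refl

graham-α : ∀ i → GrahamNonnegative (α i)
graham-α i = ℕPoly.var i , ≈-refl

graham-⊕ : ∀ {p q} → GrahamNonnegative p → GrahamNonnegative q → GrahamNonnegative (p ⊕ q)
graham-⊕ (r , p≈r) (s , q≈s) = r ℕPoly.⊕ s , ⊕-cong p≈r q≈s

graham-⊗ : ∀ {p q} → GrahamNonnegative p → GrahamNonnegative q → GrahamNonnegative (p ⊗ q)
graham-⊗ (r , p≈r) (s , q≈s) = r ℕPoly.⊗ s , ⊗-cong p≈r q≈s

-- `≤′` recurses on the upper index, peeling off the top simple root: y_(j+1) - y_i = α_j + (y_j -
-- y_i).
graham-root : ∀ {i j} → i ≤′ j → GrahamNonnegative (var j ⊖ var i)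
graham-root {i} ≤′-refl = graham-resp-≈ (≈-sym (⊖-inverseʳ (var i))) (graham-con 0)
graham-root {i} (≤′-step {j} i≤j) = graham-resp-≈ (⊖-telescope (var (suc j)) (var j) (var i))
  (graham-⊕ (graham-α j) (graham-root i≤j))

-- `z≔y` computes through `∏`, so the substituted product is the product of the substituted factors.
graham-∏ : ∀ {ps} → All (GrahamNonnegative ∘ z≔y) ps → GrahamNonnegative (z≔y (∏ ps))
graham-∏ []         = graham-con 1
graham-∏ (gp ∷ gps) = graham-⊗ gp (graham-∏ gps)

vanishing-∏ : ∀ {ps} → Any (λ p → z≔y p ≈ con (+ 0)) ps → z≔y (∏ ps) ≈ con (+ 0)
vanishing-∏ {p ∷ ps} (here p≈0) = ≈-trans (⊗-cong p≈0 ≈-refl) (⊗-zeroˡ _)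
vanishing-∏ {p ∷ ps} (there a)  =
  ≈-trans (⊗-comm _ _) (≈-trans (⊗-cong (vanishing-∏ a) ≈-refl) (⊗-zeroˡ _))

theorem6p1 : (u w : S∞) (μ : Partition) (P : Path μ u w) →
    GrahamNonnegative (z≔y (weight P))
theorem6p1 u w μ P with Fin.any? (λ i → any? (toℕ i ≟_) (fixedValues P i))
-- The inner `vanishing-∏` annihilates the weight of step `i`, the outer one the whole product.
... | yes (i , i∈) = graham-resp-≈ (≈-sym (vanishing-∏ (Any.tabulate⁺ i (vanishing-∏ (Any.map⁺
        (Any.map (λ { refl → ⊖-inverseʳ (var (toℕ i)) }) i∈))))))
      (graham-con 0)
-- Without a zero factor, every y_v - y_i has i ≤ v.
... | no  ∄zero    = graham-∏ (All.tabulate⁺ λ i → graham-∏ (All.map⁺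
        (All.tabulate λ v∈ → graham-root (ℕ.≤⇒≤′
          (index≤fixedValue P (λ i i∈ → ∄zero (i , i∈)) i v∈)))))
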